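{- Every avoidable hybrid formula is avoided by $b_4$.
   Context: A formula is a finite set of non-empty words over variables (fragments), written separated by dots. An occurrence of a formula $f$ in a word $w$ is a non-erasing morphism $h$ from variables to non-empty words such that $h(\phi)$ is a factor of $w$ for every fragment $\phi$; $w$ avoids $f$ if it has no occurrence; $f$ is avoidable if some infinite word over a finite alphabet avoids it. A formula is hybrid if each of its fragments either has length $2$ or has the form $XYX$ with $X,Y$ variables (possibly equal). $b_4$ is the fixed point starting with $0$ of the morphism $0\mapsto 01,\ 1\mapsto 03,\ 2\mapsto 21,\ 3\mapsto 23$. -}

module Defs where

open import Data.Nat using (ℕ; zero; suc; _+_; _<_)
open import Data.Fin using (Fin)
open import Data.List using (List; []; _∷_; length; concatMap; lookup)
open import Data.List.Membership.Propositional using (_∈_)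
open import Data.List.Relation.Unary.All using (All)
open import Data.Product using (Σ; ∃; _×_; _,_)
open import Data.Sum using (_⊎_)
open import Data.Empty using (⊥)
open import Relation.Nullary using (¬_)
open import Relation.Binary.PropositionalEquality using (_≡_; _≢_)

Var : Set
Var = ℕ

-- A fragment is a word over variables; a formula is a finite set
-- (represented as a list) of fragments.
Fragment : Set
Fragment = List Var

Formula : Set
Formula = List Fragment

InfWord : Set → Set
InfWord A = ℕ → A

Factor : {A : Set} → List A → InfWord A → Set
Factor {A} u w = ∃ λ i → (j : ℕ) → (p : j < length u) →
  w (i + j) ≡ lookup u (Data.Fin.fromℕ< p)

applyMorph : {A : Set} → (Var → List A) → Fragment → List A
applyMorph h φ = concatMap h φ

Occurrence : {A : Set} → Formula → InfWord A → (Var → List A) → Set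
Occurrence f w h =
  ((x : Var) → h x ≢ []) × ((φ : Fragment) → φ ∈ f → Factor (applyMorph h φ) w)

Avoids : {A : Set} → InfWord A → Formula → Set
Avoids {A} w f = ¬ (Σ (Var → List A) λ h → Occurrence f w h)

Avoidable : Formula → Set
Avoidable f = ∃ λ (k : ℕ) → Σ (InfWord (Fin k)) λ w → Avoids w f

HybridFragment : Fragment → Set
HybridFragment φ =
  (length φ ≡ 2) ⊎ (∃ λ (X : Var) → ∃ λ (Y : Var) → φ ≡ X ∷ Y ∷ X ∷ [])

-- Every fragment of the formula is non-empty (part of the definition of
-- formula) and the formula is hybrid.
Hybrid : Formula → Set
Hybrid f = All HybridFragment f

-- The morphism 0↦01, 1↦03, 2↦21, 3↦23 on the alphabet {0,1,2,3}.
σ : ℕ → List ℕ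
σ 0 = 0 ∷ 1 ∷ []
σ 1 = 0 ∷ 3 ∷ []
σ 2 = 2 ∷ 1 ∷ []
σ _ = 2 ∷ 3 ∷ []

σ* : List ℕ → List ℕ
σ* = concatMap σ

iterσ : ℕ → List ℕ → List ℕ
iterσ zero u = u
iterσ (suc n) u = σ* (iterσ n u)

nth : List ℕ → ℕ → ℕ
nth [] _ = 0
nth (a ∷ _) zero = a
nth (_ ∷ u) (suc i) = nth u i

-- b4 i is the i-th letter of σ^(i+1)(0), which has length 2^(i+1) > i and
-- is a prefix of the fixed point of σ starting with 0.
b4ℕ : InfWord ℕ
b4ℕ i = nth (iterσ (suc i) (0 ∷ [])) i

{-# OPTIONS --safe #-}
-- Write β for b₄.  The letter β n determines n mod 2, odd letters determine n mod 4, and the even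
-- positions of β, halved, spell β again.  So two occurrences of a word of length at least 2 start at
-- positions congruent mod 4, and halving positions turns an occurrence of a formula in β into a
-- shorter one as long as no variable becomes empty or ambiguous.
--
-- Suppose f occurs in β.  Halve until some variable has length 1: the parities of the borders of the
-- variables then form a consistent 2-colouring of the adjacency graph in which this variable is free
-- (its borders have different colours).  A free variable can be deleted unless it is the middle of a
-- fragment YXY, in which case Y is free as well.  Cycles X₀X₁X₀, …, XₙX₀Xₙ do not occur in β, again
-- by descent, so some free variable can be deleted.  Iterating, f reduces to the empty formula;
-- reinserting the variables one by one gives an occurrence of f in a Zimin word, and Zimin words are
-- unavoidable.

module Submission where

open import Defs
open import Data.Bool using (Bool; true; false; not)
import Data.Bool.Properties as Bool
open import Data.Empty using (⊥-elim)
open import Data.Fin using (Fin; fromℕ<; toℕ; funToFin; finToFun)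
open import Data.Fin.Properties using (pigeonhole; finToFun-funToFin; toℕ<n; toℕ-fromℕ<)
open import Data.List using (List; []; _∷_; _++_; [_]; length; lookup; drop; filter; concat; concatMap)
open import Data.List.Properties using (∷-injective; ++-assoc; ++-identityʳ; length-++; concatMap-++; filter-notAll; ≡-dec)
open import Data.List.Membership.Propositional using (_∈_; find; lose)
open import Data.List.Membership.Propositional.Properties using (∈-filter⁺; ∈-filter⁻; ∈-concat⁺′; ∈-concat⁻′)
import Data.List.Membership.DecPropositional as DecMembership
open import Data.List.Relation.Unary.All using (All; []; _∷_)
import Data.List.Relation.Unary.All as All
open import Data.List.Relation.Unary.All.Properties using (++⁺)
open import Data.List.Relation.Unary.Any using (Any; here; there; any?; index)
open import Data.List.Relation.Unary.Any.Properties using (lookup-index)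
open import Data.Nat
open import Data.Nat.DivMod
open import Data.Nat.Divisibility using (divides-refl)
open import Data.Nat.Induction using (<-rec)
open import Data.Nat.Properties
open import Data.Product using (∃; _×_; _,_; proj₁; proj₂)
open import Data.Sum using (_⊎_; inj₁; inj₂)
open import Relation.Nullary using (¬_; Dec; yes; no)
open import Relation.Nullary.Decidable using (_×-dec_; ¬?)
open import Relation.Binary.PropositionalEquality using (_≡_; _≢_; refl; sym; trans; cong; cong₂; subst; subst₂; module ≡-Reasoning)

-- The word b₄

σ₀ σ₁ : ℕ → ℕ
σ₀ a = nth (σ a) 0
σ₁ a = nth (σ a) 1

σ-pair : ∀ a → σ a ≡ σ₀ a ∷ σ₁ a ∷ []
σ-pair 0 = refl
σ-pair 1 = refl
σ-pair 2 = refl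
σ-pair (suc (suc (suc _))) = refl

nth-++ : ∀ u v {i} → i < length u → nth (u ++ v) i ≡ nth u i
nth-++ (_ ∷ _) _ {zero} _ = refl
nth-++ (_ ∷ u) v {suc i} (s≤s p) = nth-++ u v p

nth-σ*-even : ∀ u {i} → i < length u → nth (σ* u) (i + i) ≡ σ₀ (nth u i)
nth-σ*-even (a ∷ u) {i} p rewrite σ-pair a with i | p
... | zero | _ = refl
... | suc j | s≤s q rewrite +-suc j j = nth-σ*-even u q

nth-σ*-odd : ∀ u {i} → i < length u → nth (σ* u) (suc (i + i)) ≡ σ₁ (nth u i)
nth-σ*-odd (a ∷ u) {i} p rewrite σ-pair a with i | p
... | zero | _ = refl
... | suc j | s≤s q rewrite +-suc j j = nth-σ*-odd u q

length-σ* : ∀ u → length (σ* u) ≡ length u + length u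
length-σ* [] = refl
length-σ* (a ∷ u) rewrite σ-pair a | +-suc (length u) (length u) = cong (λ n → suc (suc n)) (length-σ* u)

prefixes : ℕ → List ℕ
prefixes n = iterσ n (0 ∷ [])

n<length-prefixes : ∀ n → n < length (prefixes n)
n<length-prefixes zero = s≤s z≤n
n<length-prefixes (suc n) rewrite length-σ* (prefixes n) =
  ≤-trans (s≤s (n<length-prefixes n)) (+-monoˡ-≤ (length (prefixes n)) (≤-trans (s≤s z≤n) (n<length-prefixes n)))

prefixes-suc : ∀ n → ∃ λ v → prefixes (suc n) ≡ prefixes n ++ v
prefixes-suc zero = 1 ∷ [] , refl
prefixes-suc (suc n) with prefixes-suc n
... | v , eq = σ* v , trans (cong σ* eq) (concatMap-++ σ (prefixes n) v)

nth-prefixes-+ : ∀ k n {i} → i < length (prefixes n) → nth (prefixes (k + n)) i ≡ nth (prefixes n) i × i < length (prefixes (k + n))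
nth-prefixes-+ zero n p = refl , p
nth-prefixes-+ (suc k) n {i} p with nth-prefixes-+ k n p | prefixes-suc (k + n)
... | eq , q | v , eq' rewrite eq' =
  trans (nth-++ (prefixes (k + n)) v q) eq ,
  ≤-trans q (≤-trans (m≤m+n _ (length v)) (≤-reflexive (sym (length-++ (prefixes (k + n))))))

-- `prefixes (suc i)` and `prefixes n` are both prefixes of `prefixes (n + suc i)`, hence agree at
-- `i`.
b4-nth : ∀ n i → i < length (prefixes n) → b4ℕ i ≡ nth (prefixes n) i
b4-nth n i p = trans (sym (proj₁ (nth-prefixes-+ n (suc i) (<-trans (n<1+n i) (n<length-prefixes (suc i))))))
  (trans (cong (λ m → nth (prefixes m) i) (+-comm n (suc i))) (proj₁ (nth-prefixes-+ (suc i) n p)))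

b4-even : ∀ i → b4ℕ (i + i) ≡ σ₀ (b4ℕ i)
b4-even i = trans (nth-σ*-even (prefixes (i + i)) p) (cong σ₀ (sym (b4-nth (i + i) i p)))
  where p = ≤-trans (s≤s (m≤m+n i i)) (n<length-prefixes (i + i))

b4-odd : ∀ i → b4ℕ (suc (i + i)) ≡ σ₁ (b4ℕ i)
b4-odd i = trans (nth-σ*-odd (prefixes (suc (i + i))) p) (cong σ₁ (sym (b4-nth (suc (i + i)) i p)))
  where p = ≤-trans (s≤s (≤-trans (m≤m+n i i) (n≤1+n _))) (n<length-prefixes (suc (i + i)))

data ParityView : ℕ → Set where
  even : ∀ i → ParityView (i + i)
  odd  : ∀ i → ParityView (suc (i + i))

parityView : ∀ n → ParityView n
parityView zero = even 0
parityView (suc n) with parityView n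
... | even i = odd i
... | odd i = subst ParityView (cong suc (+-suc i i)) (even (suc i))

i+i%2 : ∀ i → (i + i) % 2 ≡ 0
i+i%2 zero = refl
i+i%2 (suc i) rewrite +-suc i i = i+i%2 i

1+i+i%2 : ∀ i → suc (i + i) % 2 ≡ 1
1+i+i%2 zero = refl
1+i+i%2 (suc i) rewrite +-suc i i = 1+i+i%2 i

-- `σ` sends every number from 3 on to the same word, so recovering a letter from its image needs
-- the alphabet to be exactly 0 to 3.
data Letter : ℕ → Set where
  l0 : Letter 0
  l1 : Letter 1
  l2 : Letter 2
  l3 : Letter 3

σ₀-letter : ∀ a → Letter (σ₀ a) × σ₀ a % 2 ≡ 0
σ₀-letter 0 = l0 , refl
σ₀-letter 1 = l0 , refl
σ₀-letter 2 = l2 , refl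
σ₀-letter (suc (suc (suc _))) = l2 , refl

σ₁-letter : ∀ a → Letter (σ₁ a) × σ₁ a % 2 ≡ 1
σ₁-letter 0 = l1 , refl
σ₁-letter 1 = l3 , refl
σ₁-letter 2 = l1 , refl
σ₁-letter (suc (suc (suc _))) = l3 , refl

b4-letter : ∀ n → Letter (b4ℕ n) × b4ℕ n % 2 ≡ n % 2
b4-letter n with parityView n
... | even i rewrite b4-even i | i+i%2 i = σ₀-letter (b4ℕ i)
... | odd i rewrite b4-odd i | 1+i+i%2 i = σ₁-letter (b4ℕ i)

b4-mod2 : ∀ m n → b4ℕ m ≡ b4ℕ n → m % 2 ≡ n % 2
b4-mod2 m n eq = trans (sym (proj₂ (b4-letter m))) (trans (cong (_% 2) eq) (proj₂ (b4-letter n)))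

σ₁-mod2 : ∀ {a b} → Letter a → Letter b → σ₁ a ≡ σ₁ b → a % 2 ≡ b % 2
σ₁-mod2 l0 l0 _ = refl
σ₁-mod2 l0 l2 _ = refl
σ₁-mod2 l1 l1 _ = refl
σ₁-mod2 l1 l3 _ = refl
σ₁-mod2 l2 l0 _ = refl
σ₁-mod2 l2 l2 _ = refl
σ₁-mod2 l3 l1 _ = refl
σ₁-mod2 l3 l3 _ = refl

σ₀-injective : ∀ {a b} → Letter a → Letter b → a % 2 ≡ b % 2 → σ₀ a ≡ σ₀ b → a ≡ b
σ₀-injective l0 l0 _ _ = refl
σ₀-injective l1 l1 _ _ = refl
σ₀-injective l2 l2 _ _ = refl
σ₀-injective l3 l3 _ _ = refl

-- `σ₀` identifies 0 with 1 and 2 with 3; the parity of a letter, which is that of its position,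
-- tells them apart.
b4-half : ∀ i j → i % 2 ≡ j % 2 → b4ℕ (i + i) ≡ b4ℕ (j + j) → b4ℕ i ≡ b4ℕ j
b4-half i j p eq = σ₀-injective (proj₁ (b4-letter i)) (proj₁ (b4-letter j))
  (trans (proj₂ (b4-letter i)) (trans p (sym (proj₂ (b4-letter j)))))
  (trans (sym (b4-even i)) (trans eq (b4-even j)))

-- The letter at an odd position is 1 or 3 according to the parity of `b4ℕ i`, which is that of `i`.
b4-odd-mod2 : ∀ i j → b4ℕ (suc (i + i)) ≡ b4ℕ (suc (j + j)) → i % 2 ≡ j % 2
b4-odd-mod2 i j eq = trans (sym (proj₂ (b4-letter i))) (trans
  (σ₁-mod2 (proj₁ (b4-letter i)) (proj₁ (b4-letter j)) (trans (sym (b4-odd i)) (trans eq (b4-odd j))))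
  (proj₂ (b4-letter j)))

-- Matching intervals

infix 4 _≈_[_]

-- A record instead of the bare equation, so that `m`, `n` and `d` can be inferred from the type
-- although `%` computes. `Match` is wrapped likewise.
record _≈_[_] (m n d : ℕ) .{{_ : NonZero d}} : Set where
  constructor mk≈
  field residues : m % d ≡ n % d

open _≈_[_]

module _ {d : ℕ} .{{_ : NonZero d}} where

  ≈-refl : ∀ {m} → m ≈ m [ d ]
  ≈-refl = mk≈ refl

  ≈-reflexive : ∀ {m n} → m ≡ n → m ≈ n [ d ]
  ≈-reflexive refl = ≈-refl

  ≈-sym : ∀ {m n} → m ≈ n [ d ] → n ≈ m [ d ]
  ≈-sym (mk≈ p) = mk≈ (sym p)

  ≈-trans : ∀ {m n o} → m ≈ n [ d ] → n ≈ o [ d ] → m ≈ o [ d ]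
  ≈-trans (mk≈ p) (mk≈ q) = mk≈ (trans p q)

  +-cong≈ : ∀ {m m′ n n′} → m ≈ m′ [ d ] → n ≈ n′ [ d ] → m + n ≈ m′ + n′ [ d ]
  +-cong≈ {m} {m′} {n} {n′} (mk≈ p) (mk≈ q) = mk≈ (trans (%-distribˡ-+ m n d)
    (trans (cong₂ (λ x y → (x + y) % d) p q) (sym (%-distribˡ-+ m′ n′ d))))

  -- Adding the complement d ∸ c % d undoes the addition of c modulo d.
  +-cancelˡ≈ : ∀ c {m n} → c + m ≈ c + n [ d ] → m ≈ n [ d ]
  +-cancelˡ≈ c p = ≈-trans (≈-sym undo) (≈-trans (+-cong≈ (≈-refl {d ∸ c % d}) p) undo)
    where
    d∸c+c : (d ∸ c % d) + c ≈ 0 [ d ]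
    d∸c+c = ≈-trans (+-cong≈ ≈-refl (mk≈ (sym (m%n%n≡m%n c d))))
      (≈-trans (≈-reflexive (m∸n+n≡m (m%n≤n c d))) (mk≈ (trans (n%n≡0 d) (sym (m<n⇒m%n≡m (>-nonZero⁻¹ d))))))
    undo : ∀ {k} → (d ∸ c % d) + (c + k) ≈ k [ d ]
    undo {k} = ≈-trans (≈-reflexive (sym (+-assoc (d ∸ c % d) c k))) (+-cong≈ d∸c+c ≈-refl)

  +-cancelʳ≈ : ∀ c {m n} → m + c ≈ n + c [ d ] → m ≈ n [ d ]
  +-cancelʳ≈ c {m} {n} p = +-cancelˡ≈ c
    (≈-trans (≈-reflexive (+-comm c m)) (≈-trans p (≈-reflexive (+-comm n c))))

≈4⇒≈2 : ∀ {m n} → m ≈ n [ 4 ] → m ≈ n [ 2 ]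
≈4⇒≈2 {m} {n} (mk≈ p) = mk≈ (trans (sym (m∣n⇒o%n%m≡o%m 2 4 m (divides-refl 2)))
  (trans (cong (_% 2) p) (m∣n⇒o%n%m≡o%m 2 4 n (divides-refl 2))))

≈8⇒≈4 : ∀ {m n} → m ≈ n [ 8 ] → m ≈ n [ 4 ]
≈8⇒≈4 {m} {n} (mk≈ p) = mk≈ (trans (sym (m∣n⇒o%n%m≡o%m 4 8 m (divides-refl 2)))
  (trans (cong (_% 4) p) (m∣n⇒o%n%m≡o%m 4 8 n (divides-refl 2))))

double-2⇒4 : ∀ {m n} → m ≈ n [ 2 ] → m + m ≈ n + n [ 4 ]
double-2⇒4 {m} {n} (mk≈ p) = mk≈ (trans (dbl m) (trans (cong (λ k → k + k) p) (sym (dbl n))))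
  where
  dbl : ∀ i → (i + i) % 4 ≡ i % 2 + i % 2
  dbl 0 = refl
  dbl 1 = refl
  dbl (suc (suc i)) rewrite +-suc i (suc i) | +-suc i i = dbl i

double-4⇒8 : ∀ {m n} → m ≈ n [ 4 ] → m + m ≈ n + n [ 8 ]
double-4⇒8 {m} {n} (mk≈ p) = mk≈ (trans (dbl m) (trans (cong (λ k → k + k) p) (sym (dbl n))))
  where
  dbl : ∀ i → (i + i) % 8 ≡ i % 4 + i % 4
  dbl 0 = refl
  dbl 1 = refl
  dbl 2 = refl
  dbl 3 = refl
  dbl (suc (suc (suc (suc i))))
    rewrite +-suc i (suc (suc (suc i))) | +-suc i (suc (suc i)) | +-suc i (suc i) | +-suc i i = dbl i

≈0⊎≈1 : ∀ n → n ≈ 0 [ 2 ] ⊎ n ≈ 1 [ 2 ]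
≈0⊎≈1 0 = inj₁ ≈-refl
≈0⊎≈1 1 = inj₂ ≈-refl
≈0⊎≈1 (suc (suc n)) with ≈0⊎≈1 n
... | inj₁ (mk≈ p) = inj₁ (mk≈ p)
... | inj₂ (mk≈ p) = inj₂ (mk≈ p)

mod4-cases : ∀ m → m ≈ 1 [ 2 ] ⊎ m ≈ 2 [ 4 ] ⊎ m ≈ 0 [ 4 ]
mod4-cases 0 = inj₂ (inj₂ ≈-refl)
mod4-cases 1 = inj₁ ≈-refl
mod4-cases 2 = inj₂ (inj₁ ≈-refl)
mod4-cases 3 = inj₁ (mk≈ refl)
mod4-cases (suc (suc (suc (suc m)))) with mod4-cases m
... | inj₁ (mk≈ p) = inj₁ (mk≈ p)
... | inj₂ (inj₁ (mk≈ p)) = inj₂ (inj₁ (mk≈ p))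
... | inj₂ (inj₂ (mk≈ p)) = inj₂ (inj₂ (mk≈ p))

odd-form : ∀ {n} → n ≈ 1 [ 2 ] → ∃ λ i → n ≡ suc (i + i)
odd-form {n} (mk≈ p) with parityView n
... | odd i = i , refl
... | even i with trans (sym p) (i+i%2 i)
... | ()

4k+2-form : ∀ {n} → n ≈ 2 [ 4 ] → ∃ λ i → n ≡ suc (i + i) + suc (i + i)
4k+2-form {2} _ = 0 , refl
4k+2-form {0} (mk≈ ())
4k+2-form {1} (mk≈ ())
4k+2-form {3} (mk≈ ())
4k+2-form {suc (suc (suc (suc n)))} (mk≈ p) with 4k+2-form {n} (mk≈ p)
... | i , refl = suc i , lemma
  where
  lemma : 4 + (suc (i + i) + suc (i + i)) ≡ suc (suc i + suc i) + suc (suc i + suc i)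
  lemma rewrite +-suc i i | +-suc (i + i) (suc (suc (i + i)))
    | +-suc (i + i) (suc (i + i)) | +-suc (i + i) (i + i) = refl

⌈n/2⌉-double : ∀ n → ⌈ n /2⌉ + ⌈ n /2⌉ ≡ n + n % 2
⌈n/2⌉-double 0 = refl
⌈n/2⌉-double 1 = refl
⌈n/2⌉-double (suc (suc n)) rewrite +-suc ⌈ n /2⌉ ⌈ n /2⌉ = cong (λ k → suc (suc k)) (⌈n/2⌉-double n)

⌈/2⌉-≈4⇒≈2 : ∀ {m n} → m ≈ n [ 4 ] → ⌈ m /2⌉ ≈ ⌈ n /2⌉ [ 2 ]
⌈/2⌉-≈4⇒≈2 {m} {n} (mk≈ eq) = mk≈ (trans (up m) (trans (cong (λ k → ⌈ k /2⌉ % 2) eq) (sym (up n))))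
  where
  up : ∀ n → ⌈ n /2⌉ % 2 ≡ ⌈ n % 4 /2⌉ % 2
  up 0 = refl
  up 1 = refl
  up 2 = refl
  up 3 = refl
  up (suc (suc (suc (suc n)))) = up n

b4-mod4 : ∀ m n → m ≈ 1 [ 2 ] → b4ℕ m ≡ b4ℕ n → m ≈ n [ 4 ]
b4-mod4 m n p eq with odd-form p | odd-form {n} (≈-trans (mk≈ (sym (b4-mod2 m n eq))) p)
... | i , refl | j , refl = +-cong≈ (≈-refl {m = 1}) (double-2⇒4 {i} {j} (mk≈ (b4-odd-mod2 i j eq)))

-- Halving leads to odd positions with equal letters, which fix these positions modulo 4; doubling
-- back gives modulus 8.
b4-mod8 : ∀ m n → m ≈ 2 [ 4 ] → n ≈ 2 [ 4 ] → b4ℕ m ≡ b4ℕ n → m ≈ n [ 8 ]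
b4-mod8 m n p q eq with 4k+2-form p | 4k+2-form q
... | i , refl | j , refl = double-4⇒8 (+-cong≈ (≈-refl {m = 1}) (double-2⇒4 {i} {j} (mk≈ (b4-odd-mod2 i j
    (b4-half (suc (i + i)) (suc (j + j)) (trans (1+i+i%2 i) (sym (1+i+i%2 j))) eq)))))

record Match (c c′ n : ℕ) : Set where
  constructor mkMatch
  field at : ∀ {i} → i < n → b4ℕ (c + i) ≡ b4ℕ (c′ + i)

open Match

Match-sym : ∀ {c c′ n} → Match c c′ n → Match c′ c n
Match-sym M = mkMatch λ p → sym (at M p)

Match-trans : ∀ {c c′ c″ n} → Match c c′ n → Match c′ c″ n → Match c c″ n
Match-trans M N = mkMatch λ p → trans (at M p) (at N p)

Match-head : ∀ {c c′ n} → 0 < n → Match c c′ n → b4ℕ c ≡ b4ℕ c′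
Match-head {c} {c′} p M = subst₂ (λ x y → b4ℕ x ≡ b4ℕ y) (+-identityʳ c) (+-identityʳ c′) (at M p)

Match-≈2 : ∀ {c c′ n} → 0 < n → Match c c′ n → c ≈ c′ [ 2 ]
Match-≈2 {c} {c′} p M = mk≈ (b4-mod2 c c′ (Match-head p M))

Match-odd-≈4 : ∀ {c c′ n} → c ≈ 1 [ 2 ] → 0 < n → Match c c′ n → c ≈ c′ [ 4 ]
Match-odd-≈4 {c} {c′} q p M = b4-mod4 c c′ q (Match-head p M)

-- One of the first two positions is odd, and its letter fixes it modulo 4.
Match-≈4 : ∀ {c c′ n} → 1 < n → Match c c′ n → c ≈ c′ [ 4 ]
Match-≈4 {c} {c′} p M with ≈0⊎≈1 c
... | inj₂ q = Match-odd-≈4 q (<-trans (s≤s z≤n) p) M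
... | inj₁ q = +-cancelʳ≈ 1 (b4-mod4 (c + 1) (c′ + 1) (+-cong≈ q (≈-refl {m = 1})) (at M p))

-- The number of even positions in [c, c + n); the first of them is the double of `⌈ c /2⌉`.
half-length : ℕ → ℕ → ℕ
half-length 0 n = ⌈ n /2⌉
half-length 1 n = ⌊ n /2⌋
half-length (suc (suc c)) n = half-length c n

⌈c+n/2⌉ : ∀ c n → ⌈ c + n /2⌉ ≡ ⌈ c /2⌉ + half-length c n
⌈c+n/2⌉ 0 n = refl
⌈c+n/2⌉ 1 n = refl
⌈c+n/2⌉ (suc (suc c)) n = cong suc (⌈c+n/2⌉ c n)

half-length-% : ∀ c n → half-length c n ≡ half-length (c % 2) n
half-length-% 0 n = refl
half-length-% 1 n = refl
half-length-% (suc (suc c)) n = half-length-% c n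

half-length-cong : ∀ {c c′} n → c ≈ c′ [ 2 ] → half-length c n ≡ half-length c′ n
half-length-cong {c} {c′} n (mk≈ eq) =
  trans (half-length-% c n) (trans (cong (λ r → half-length r n) eq) (sym (half-length-% c′ n)))

-- `c % 2 + (i + i)` is the distance from `c` to the even position number `i` of the interval.
<half-length : ∀ c n i → i < half-length c n → c % 2 + (i + i) < n
<half-length 0 (suc n) zero _ = s≤s z≤n
<half-length 0 (suc zero) (suc i) (s≤s ())
<half-length 0 (suc (suc n)) (suc i) (s≤s p) rewrite +-suc i i = s≤s (s≤s (<half-length 0 n i p))
<half-length 1 (suc (suc n)) zero _ = s≤s (s≤s z≤n)
<half-length 1 (suc (suc n)) (suc i) (s≤s p) rewrite +-suc i i = s≤s (s≤s (<half-length 1 n i p))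
<half-length (suc (suc c)) n i p = <half-length c n i p

half-length-pos : ∀ c n → 1 < n → 0 < half-length c n
half-length-pos 0 (suc (suc n)) _ = s≤s z≤n
half-length-pos 1 (suc (suc n)) _ = s≤s z≤n
half-length-pos 0 (suc zero) (s≤s ())
half-length-pos 1 (suc zero) (s≤s ())
half-length-pos (suc (suc c)) n p = half-length-pos c n p

half-length-< : ∀ c n → 1 < n → half-length c n < n
half-length-< 0 (suc (suc n)) _ = s≤s (s≤s (⌈n/2⌉≤n n))
half-length-< 1 (suc (suc n)) _ = s≤s (s≤s (⌊n/2⌋≤n n))
half-length-< 0 (suc zero) (s≤s ())
half-length-< 1 (suc zero) (s≤s ())
half-length-< (suc (suc c)) n p = half-length-< c n p

-- Read off at the even positions. Congruence modulo 4 gives the halved positions equal parities, as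
-- `b4-half` requires.
Match-half : ∀ {c c′ n} → c ≈ c′ [ 4 ] → Match c c′ n → Match ⌈ c /2⌉ ⌈ c′ /2⌉ (half-length c n)
Match-half {c} {c′} {n} q M = mkMatch λ {i} p →
  b4-half (⌈ c /2⌉ + i) (⌈ c′ /2⌉ + i) (residues (+-cong≈ (⌈/2⌉-≈4⇒≈2 q) ≈-refl))
    (subst₂ (λ x y → b4ℕ x ≡ b4ℕ y) (sym (place c i))
      (trans (cong (λ r → c′ + (r + (i + i))) (residues (≈4⇒≈2 q))) (sym (place c′ i)))
      (at M (<half-length c n i p)))
  where
  open ≡-Reasoning
  place : ∀ c i → (⌈ c /2⌉ + i) + (⌈ c /2⌉ + i) ≡ c + (c % 2 + (i + i))
  place c i = begin
    (⌈ c /2⌉ + i) + (⌈ c /2⌉ + i) ≡⟨ +-assoc ⌈ c /2⌉ i _ ⟩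
    ⌈ c /2⌉ + (i + (⌈ c /2⌉ + i)) ≡⟨ cong (⌈ c /2⌉ +_) (+-comm i _) ⟩
    ⌈ c /2⌉ + (⌈ c /2⌉ + i + i)   ≡⟨ cong (⌈ c /2⌉ +_) (+-assoc ⌈ c /2⌉ i i) ⟩
    ⌈ c /2⌉ + (⌈ c /2⌉ + (i + i)) ≡⟨ +-assoc ⌈ c /2⌉ _ _ ⟨
    ⌈ c /2⌉ + ⌈ c /2⌉ + (i + i)   ≡⟨ cong (_+ (i + i)) (⌈n/2⌉-double c) ⟩
    c + c % 2 + (i + i)           ≡⟨ +-assoc c _ _ ⟩
    c + (c % 2 + (i + i))         ∎

-- Cycles of fragments YXY

-- Descent on the period: a square of period at least 2 halves to a shorter one, and period 1 would
-- repeat a letter at positions of different parity.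
squareFree : ∀ p c → 0 < p → ¬ Match c (c + p) p
squareFree = <-rec (λ p → ∀ c → 0 < p → ¬ Match c (c + p) p) step
  where
  step : ∀ p → (∀ {q} → q < p → ∀ c → 0 < q → ¬ Match c (c + q) q) → ∀ c → 0 < p → ¬ Match c (c + p) p
  step (suc zero) rec c _ M with +-cancelˡ≈ c (≈-trans (≈-reflexive (+-identityʳ c)) (Match-≈2 (s≤s z≤n) M))
  ... | mk≈ ()
  step p@(suc (suc _)) rec c _ M = rec (half-length-< c p (s≤s (s≤s z≤n))) ⌈ c /2⌉ (half-length-pos c p (s≤s (s≤s z≤n)))
    (subst (λ k → Match ⌈ c /2⌉ k (half-length c p)) (⌈c+n/2⌉ c p) (Match-half (Match-≈4 (s≤s (s≤s z≤n)) M) M))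

⌈1+odd/2⌉ : ∀ {a} → a ≈ 1 [ 2 ] → ⌈ suc a /2⌉ ≡ ⌈ a /2⌉
⌈1+odd/2⌉ {0} (mk≈ ())
⌈1+odd/2⌉ {1} _ = refl
⌈1+odd/2⌉ {suc (suc a)} (mk≈ p) = cong suc (⌈1+odd/2⌉ {a} (mk≈ p))

⌈1+even/2⌉ : ∀ {a} → a ≈ 0 [ 2 ] → ⌈ suc a /2⌉ ≡ suc ⌈ a /2⌉
⌈1+even/2⌉ {0} _ = refl
⌈1+even/2⌉ {1} (mk≈ ())
⌈1+even/2⌉ {suc (suc a)} (mk≈ p) = cong suc (⌈1+even/2⌉ {a} (mk≈ p))

-- The even positions of uxu, with x a single letter at an odd position, form a square.
no-odd-gap : ∀ {c l a} → c + l ≡ a → a ≈ 1 [ 2 ] → 1 < l → ¬ Match c (suc a) l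
no-odd-gap {c} {l} refl p q M = squareFree (half-length c l) ⌈ c /2⌉ (half-length-pos c l q)
  (subst (λ k → Match ⌈ c /2⌉ k (half-length c l)) (trans (⌈1+odd/2⌉ p) (⌈c+n/2⌉ c l)) (Match-half (Match-≈4 q M) M))

-- Halving keeps the gap, now a single letter at an odd position, and leaves at least two letters on
-- each side of it.
no-2mod4-gap : ∀ {c l a} → c + l ≡ a → a ≈ 2 [ 4 ] → 3 < l → ¬ Match c (suc a) l
no-2mod4-gap {c} {l} refl p q M = no-odd-gap (sym (⌈c+n/2⌉ c l)) (⌈/2⌉-≈4⇒≈2 p) (long c l q)
  (subst (λ k → Match ⌈ c /2⌉ k (half-length c l)) (⌈1+even/2⌉ (≈-trans (≈4⇒≈2 p) (mk≈ refl)))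
    (Match-half (Match-≈4 (<-trans (s≤s (s≤s z≤n)) q) M) M))
  where
  long : ∀ c l → 3 < l → 1 < half-length c l
  long 0 (suc (suc (suc (suc l)))) _ = s≤s (s≤s z≤n)
  long 1 (suc (suc (suc (suc l)))) _ = s≤s (s≤s z≤n)
  long 0 (suc (suc (suc zero))) (s≤s (s≤s (s≤s ())))
  long 0 (suc (suc zero)) (s≤s (s≤s ()))
  long 0 (suc zero) (s≤s ())
  long 1 (suc (suc (suc zero))) (s≤s (s≤s (s≤s ())))
  long 1 (suc (suc zero)) (s≤s (s≤s ()))
  long 1 (suc zero) (s≤s ())
  long (suc (suc c)) l p = long c l p

-- Y X Y occurs with X = [a, a + l) and the first Y = [c, c + l′); another occurrence of Y starts at a′.
record Step (a l c a′ l′ : ℕ) : Set where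
  field
    adjacent : c + l′ ≡ a
    nonEmpty : 0 < l′
    left     : Match c a′ l′
    right    : Match (a + l) a′ l′

module StepProperties {a l c a′ l′ : ℕ} (S : Step a l c a′ l′) where
  open Step S

  across : Match c (a + l) l′
  across = Match-trans left (Match-sym right)

  period : c + (l′ + l) ≡ a + l
  period = trans (sym (+-assoc c l′ l)) (cong (_+ l) adjacent)

  period≈0 : ∀ {d} .{{_ : NonZero d}} → c ≈ a + l [ d ] → l′ + l ≈ 0 [ d ]
  period≈0 p = +-cancelˡ≈ c (≈-trans (≈-reflexive period) (≈-trans (≈-sym p) (≈-reflexive (sym (+-identityʳ c)))))

  start≈2 : a′ ≈ a + l [ 2 ]
  start≈2 = ≈-sym (Match-≈2 nonEmpty right)

  -- All three occurrences of Y are congruent modulo 4, which is what halving the step requires.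
  Synced : Set
  Synced = c ≈ a + l [ 4 ] × a′ ≈ a + l [ 4 ]

  synced-long : 1 < l′ → Synced
  synced-long p = Match-≈4 p across , ≈-sym (Match-≈4 p right)

  synced-odd : a + l ≈ 1 [ 2 ] → Synced
  synced-odd p = ≈-sym (Match-odd-≈4 p nonEmpty (Match-sym across)) , ≈-sym (Match-odd-≈4 p nonEmpty right)

  end≈ : Synced → a′ + l′ ≈ a [ 4 ]
  end≈ (p , q) = ≈-trans (+-cong≈ (≈-trans q (≈-sym p)) ≈-refl) (≈-reflexive adjacent)

one-or-more : ∀ {l} → 0 < l → l ≡ 1 ⊎ 1 < l
one-or-more {suc zero} _ = inj₁ refl
one-or-more {suc (suc l)} _ = inj₂ (s≤s (s≤s z≤n))

-- The numeral `r` stands for minus `k` modulo `d`, which keeps subtraction inside the natural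
-- numbers.
subtract : ∀ {d m n k} .{{_ : NonZero d}} r → m + n ≈ 0 [ d ] → n ≈ k [ d ] → r + k ≈ 0 [ d ] → m ≈ r [ d ]
subtract {n = n} {k} r p q e = +-cancelʳ≈ n (≈-trans p (≈-trans (≈-sym e) (+-cong≈ ≈-refl (≈-sym q))))

three : ∀ {l} → l ≈ 3 [ 4 ] → l ≤ 3 → l ≡ 3
three {0} (mk≈ ()) _
three {1} (mk≈ ()) _
three {2} (mk≈ ()) _
three {3} _ _ = refl
three {suc (suc (suc (suc _)))} _ (s≤s (s≤s (s≤s ())))

-- Each of these is inherited by Y = [a′, a′ + l′) from X = [a, a + l) and hence runs around a cycle.
-- Inv₁ starts after a variable of length 1 at an odd position and Inv₂ after one at 2 mod 4; both
-- exclude their starting point, so in a cycle all variables of length 1 sit at multiples of 4.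
-- From there Inv₃ starts, and it fixes all positions mod 4.
Inv₁ Inv₂ Inv₃ : ℕ → ℕ → Set
Inv₁ a l = (a ≈ 1 [ 2 ] × l ≈ 3 [ 4 ]) ⊎ (a ≈ 0 [ 2 ] × l ≈ 1 [ 4 ])
Inv₂ a l = (a ≈ 3 [ 4 ] × l ≈ 3 [ 8 ]) ⊎ (a ≈ 2 [ 4 ] × l ≈ 5 [ 8 ])
Inv₃ a l = (a ≈ 1 [ 4 ] × a + l ≈ 0 [ 4 ]) ⊎ (a ≈ 0 [ 4 ] × a + l ≈ 1 [ 4 ])

module _ {a l c a′ l′ : ℕ} (S : Step a l c a′ l′) where
  open Step S
  open StepProperties S

  -- `no-odd-gap` forces Y to have length 1 too, and its position has the parity of `a + 1`.
  Inv₁-start : a ≈ 1 [ 2 ] → l ≡ 1 → Inv₁ a′ l′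
  Inv₁-start p refl with one-or-more nonEmpty
  ... | inj₁ refl = inj₂ (≈-trans start≈2 (≈-trans (+-cong≈ p (≈-refl {m = 1})) (mk≈ refl)) , ≈-refl)
  ... | inj₂ q = ⊥-elim (no-odd-gap adjacent p q (subst (λ k → Match c k l′) (+-comm a 1) across))

  -- Once the two copies of Y are congruent modulo 4, so is their distance `l′ + l` to 0, and the
  -- length changes sign. The only other case, length 1 at an even position, is allowed anyway.
  Inv₁-step : Inv₁ a l → Inv₁ a′ l′
  Inv₁-step (inj₁ (p , q)) = inj₂ (a′-even , len (one-or-more nonEmpty))
    where
    a′-even : a′ ≈ 0 [ 2 ]
    a′-even = ≈-trans start≈2 (≈-trans (+-cong≈ p (≈4⇒≈2 q)) (mk≈ refl))
    len : l′ ≡ 1 ⊎ 1 < l′ → l′ ≈ 1 [ 4 ]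
    len (inj₁ refl) = ≈-refl
    len (inj₂ r) = subtract 1 (period≈0 (proj₁ (synced-long r))) q (mk≈ refl)
  Inv₁-step (inj₂ (p , q)) = inj₁ (≈-trans start≈2 b-odd , subtract 3 (period≈0 (proj₁ (synced-odd b-odd))) q (mk≈ refl))
    where
    b-odd : a + l ≈ 1 [ 2 ]
    b-odd = +-cong≈ p (≈4⇒≈2 q)

  -- The odd start of Y makes its length 3 modulo 4, and `no-2mod4-gap` excludes lengths above 3.
  Inv₂-start : a ≈ 2 [ 4 ] → l ≡ 1 → Inv₂ a′ l′
  Inv₂-start p refl = inj₁ (≈-trans (proj₂ sync) b≈3 , len)
    where
    b≈3 : a + 1 ≈ 3 [ 4 ]
    b≈3 = +-cong≈ p (≈-refl {m = 1})
    sync : Synced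
    sync = synced-odd (≈-trans (≈4⇒≈2 b≈3) (mk≈ refl))
    len : l′ ≈ 3 [ 8 ]
    len with l′ ≤? 3
    ... | yes q = ≈-reflexive (three (subtract 3 (period≈0 (proj₁ sync)) (≈-refl {m = 1}) (mk≈ refl)) q)
    ... | no q = ⊥-elim (no-2mod4-gap adjacent p (≰⇒> q) (subst (λ k → Match c k l′) (+-comm a 1) across))

  -- If Y contains a position congruent to 2 modulo 4, then `b4-mod8` makes `l′ + l` a multiple of
  -- 8. Modulus 8 matters: it separates length 5 from the starting length 1.
  Inv₂-step : Inv₂ a l → Inv₂ a′ l′
  Inv₂-step (inj₁ (p , q)) = go (one-or-more nonEmpty)
    where
    b≈2 : a + l ≈ 2 [ 4 ]
    b≈2 = ≈-trans (+-cong≈ p (≈8⇒≈4 q)) (mk≈ refl)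
    p8 : c ≈ 2 [ 4 ] → l′ + l ≈ 0 [ 8 ]
    p8 r = period≈0 (b4-mod8 c (a + l) r b≈2 (Match-head nonEmpty across))
    go : l′ ≡ 1 ⊎ 1 < l′ → Inv₂ a′ l′
    -- With length 1, `c` would be 2 modulo 4 and `l′ + l`, which is 1 + 3 modulo 8, would vanish
    -- modulo 8.
    go (inj₁ refl) with ≈-trans (≈-sym (p8 (+-cancelʳ≈ 1 (≈-trans (≈-reflexive adjacent) p)))) (+-cong≈ (≈-refl {m = 1}) q)
    ... | mk≈ ()
    go (inj₂ r) with synced-long r
    ... | u , v = inj₂ (≈-trans v b≈2 , subtract 5 (p8 (≈-trans u b≈2)) q (mk≈ refl))
  Inv₂-step (inj₂ (p , q)) = inj₁ (≈-trans (proj₂ sync) b≈3 , len)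
    where
    b≈3 : a + l ≈ 3 [ 4 ]
    b≈3 = ≈-trans (+-cong≈ p (≈8⇒≈4 q)) (mk≈ refl)
    sync : Synced
    sync = synced-odd (≈-trans (≈4⇒≈2 b≈3) (mk≈ refl))
    b+3≈2 : a + l + 3 ≈ 2 [ 4 ]
    b+3≈2 = ≈-trans (+-cong≈ b≈3 (≈-refl {m = 3})) (mk≈ refl)
    len : l′ ≈ 3 [ 8 ]
    len with l′ ≤? 3
    ... | yes r = ≈-reflexive (three (subtract 3 (period≈0 (proj₁ sync)) (≈8⇒≈4 q) (mk≈ refl)) r)
    -- Y starts at 3 modulo 4, so its letter at offset 3 is at 2 modulo 4, where `b4-mod8` applies.
    ... | no r = subtract 3 (period≈0 (+-cancelʳ≈ 3 (b4-mod8 (c + 3) (a + l + 3)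
      (≈-trans (+-cong≈ (proj₁ sync) (≈-refl {m = 3})) b+3≈2) b+3≈2 (at across (≰⇒> r))))) q (mk≈ refl)

  module _ (short : l′ ≡ 1 → a′ ≈ 0 [ 4 ]) where

    -- Modulo 4, Y starts where X ends and ends where X starts; for length 1 the residues come from
    -- `short`.
    Inv₃-step : Inv₃ a l → Inv₃ a′ l′
    Inv₃-step (inj₁ (p , q)) with one-or-more nonEmpty
    ... | inj₁ refl = inj₂ (short refl , +-cong≈ (short refl) (≈-refl {m = 1}))
    ... | inj₂ r = inj₂ (≈-trans (proj₂ (synced-long r)) q , ≈-trans (end≈ (synced-long r)) p)
    Inv₃-step (inj₂ (p , q)) = inj₁ (≈-trans (proj₂ sync) q , ≈-trans (end≈ sync) p)
      where
      sync : Synced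
      sync = synced-odd (≈-trans (≈4⇒≈2 q) (mk≈ refl))

    -- A single even letter does not fix its position modulo 4, so for length 1 the residues are
    -- taken from `Inv₃`; its second alternative fails by parity.
    Inv₃⇒synced : (l′ ≡ 1 → Inv₃ a l) → Synced
    Inv₃⇒synced j with one-or-more nonEmpty
    ... | inj₂ r = synced-long r
    ... | inj₁ e with j e
    ...   | inj₁ (p , q) = ≈-trans (+-cancelʳ≈ 1 (≈-trans (≈-reflexive (trans (cong (c +_) (sym e)) adjacent)) p)) (≈-sym q) ,
                           ≈-trans (short e) (≈-sym q)
    ...   | inj₂ (p , q) with ≈-trans (≈-trans (≈-sym (≈4⇒≈2 (short e))) start≈2) (≈4⇒≈2 q)
    ...     | mk≈ ()

-- Cyclically arranged fragments X(k+1) X(k) X(k+1), with X(k) = [a k, a k + ℓ k) as the middle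
-- and c k the start of the fragment.
record Cycle : Set where
  field
    a ℓ c  : ℕ → ℕ
    n      : ℕ
    a-per  : ∀ k → a (k + suc n) ≡ a k
    ℓ-per  : ∀ k → ℓ (k + suc n) ≡ ℓ k
    step   : ∀ k → Step (a k) (ℓ k) (c k) (a (suc k)) (ℓ (suc k))

module CycleProperties (C : Cycle) where
  open Cycle C

  ℓ-pos : ∀ k → 0 < ℓ k
  ℓ-pos k = subst (0 <_) (trans (cong ℓ (sym (+-suc k n))) (ℓ-per k)) (Step.nonEmpty (step (k + n)))

  -- `n` further steps from `suc k` reach `k + suc n`, which carries the same data as `k`.
  around : (P : ℕ → ℕ → Set) → (∀ k → P (a k) (ℓ k) → P (a (suc k)) (ℓ (suc k))) →
    ∀ k → P (a (suc k)) (ℓ (suc k)) → P (a k) (ℓ k)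
  around P next k p = subst₂ P (a-per k) (ℓ-per k) (subst (λ m → P (a m) (ℓ m)) (sym (+-suc k n)) (iter n))
    where
    iter : ∀ m → P (a (suc (k + m))) (ℓ (suc (k + m)))
    iter zero = subst (λ m → P (a (suc m)) (ℓ (suc m))) (sym (+-identityʳ k)) p
    iter (suc m) = subst (λ j → P (a (suc j)) (ℓ (suc j))) (sym (+-suc k m)) (next _ (iter m))

  ¬odd-one : ∀ k → ℓ k ≡ 1 → ¬ a k ≈ 1 [ 2 ]
  ¬odd-one k e p with around Inv₁ (λ j → Inv₁-step (step j)) k (Inv₁-start (step k) p e)
  ... | inj₁ (_ , q) with ≈-trans (≈-reflexive (sym e)) q
  ...   | mk≈ ()
  ¬odd-one k e p | inj₂ (q , _) with ≈-trans (≈-sym p) q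
  ...   | mk≈ ()

  ¬2mod4-one : ∀ k → ℓ k ≡ 1 → ¬ a k ≈ 2 [ 4 ]
  ¬2mod4-one k e p with around Inv₂ (λ j → Inv₂-step (step j)) k (Inv₂-start (step k) p e)
  ... | inj₁ (_ , q) with ≈-trans (≈-reflexive (sym e)) q
  ...   | mk≈ ()
  ¬2mod4-one k e p | inj₂ (_ , q) with ≈-trans (≈-reflexive (sym e)) q
  ...   | mk≈ ()

  one≈0 : ∀ k → ℓ k ≡ 1 → a k ≈ 0 [ 4 ]
  one≈0 k e with mod4-cases (a k)
  ... | inj₁ p = ⊥-elim (¬odd-one k e p)
  ... | inj₂ (inj₁ p) = ⊥-elim (¬2mod4-one k e p)
  ... | inj₂ (inj₂ p) = p

  synced : ∀ k → StepProperties.Synced (step k)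
  -- If variable `suc k` has length 1, it sits at a multiple of 4, so `Inv₃` holds for it and, once
  -- around, for variable `k`.
  synced k = Inv₃⇒synced (step k) (one≈0 (suc k)) λ e → around Inv₃ (λ j → Inv₃-step (step j) (one≈0 (suc j))) k
    (inj₂ (one≈0 (suc k) e , subst (λ m → a (suc k) + m ≈ 1 [ 4 ]) (sym e) (+-cong≈ (one≈0 (suc k) e) (≈-refl {m = 1}))))

  ℓ′ : ℕ → ℕ
  ℓ′ k = half-length (a k) (ℓ k)

  half-step : ∀ k → Step ⌈ a k /2⌉ (ℓ′ k) ⌈ c k /2⌉ ⌈ a (suc k) /2⌉ (ℓ′ (suc k))
  half-step k = record
    { adjacent = trans (cong (⌈ c k /2⌉ +_) (half-length-cong (ℓ (suc k)) (≈4⇒≈2 (≈-sym c≈a′))))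
        (trans (sym (⌈c+n/2⌉ (c k) (ℓ (suc k)))) (cong ⌈_/2⌉ adjacent))
    ; nonEmpty = pos (one-or-more (ℓ-pos (suc k)))
    ; left = subst (Match _ _) (half-length-cong (ℓ (suc k)) (≈4⇒≈2 c≈a′)) (Match-half c≈a′ left)
    ; right = subst₂ (λ x y → Match x ⌈ a (suc k) /2⌉ y) (⌈c+n/2⌉ (a k) (ℓ k)) (half-length-cong (ℓ (suc k)) (≈4⇒≈2 b≈a′))
        (Match-half b≈a′ right) }
    where
    open Step (step k)
    b≈a′ : a k + ℓ k ≈ a (suc k) [ 4 ]
    b≈a′ = ≈-sym (proj₂ (synced k))
    c≈a′ : c k ≈ a (suc k) [ 4 ]
    c≈a′ = ≈-trans (proj₁ (synced k)) b≈a′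
    pos : ℓ (suc k) ≡ 1 ⊎ 1 < ℓ (suc k) → 0 < ℓ′ (suc k)
    pos (inj₂ p) = half-length-pos (a (suc k)) (ℓ (suc k)) p
    pos (inj₁ e) = subst (0 <_) (sym (trans (half-length-cong (ℓ (suc k)) (≈4⇒≈2 (one≈0 (suc k) e))) (cong ⌈_/2⌉ e))) (s≤s z≤n)

  half : Cycle
  half = record
    { a = λ k → ⌈ a k /2⌉ ; ℓ = ℓ′ ; c = λ k → ⌈ c k /2⌉ ; n = n
    ; a-per = λ k → cong ⌈_/2⌉ (a-per k)
    ; ℓ-per = λ k → cong₂ half-length (a-per k) (ℓ-per k)
    ; step = half-step }

  half-length-≤ : ∀ k → ℓ′ k ≤ ℓ k
  half-length-≤ k with one-or-more (ℓ-pos k)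
  ... | inj₂ p = <⇒≤ (half-length-< (a k) (ℓ k) p)
  ... | inj₁ e = ≤-reflexive (trans (half-length-cong (ℓ k) (≈4⇒≈2 (one≈0 k e))) (trans (cong ⌈_/2⌉ e) (sym e)))

  -- A length above 1 shrinks. Two consecutive lengths cannot both be 1: both variables would start
  -- at even positions, but the second starts with the parity of the end of the first, which is odd.
  half-smaller : ℓ′ 0 + ℓ′ 1 < ℓ 0 + ℓ 1
  half-smaller with one-or-more (ℓ-pos 0) | one-or-more (ℓ-pos 1)
  ... | inj₂ p | _ = +-mono-<-≤ (half-length-< (a 0) (ℓ 0) p) (half-length-≤ 1)
  ... | inj₁ _ | inj₂ p = +-mono-≤-< (half-length-≤ 0) (half-length-< (a 1) (ℓ 1) p)
  ... | inj₁ e | inj₁ e′ with ≈-trans (≈-sym (≈4⇒≈2 (one≈0 1 e′))) (≈-trans (StepProperties.start≈2 (step 0))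
      (+-cong≈ (≈4⇒≈2 (one≈0 0 e)) (≈-reflexive e)))
  ...   | mk≈ ()

¬Cycle : ¬ Cycle
¬Cycle C = <-rec (λ m → (C : Cycle) → ¬ Cycle.ℓ C 0 + Cycle.ℓ C 1 ≡ m)
  (λ { _ rec C refl → rec (CycleProperties.half-smaller C) (CycleProperties.half C) refl }) _ C refl

-- Free variables

isOdd : ℕ → Bool
isOdd zero = false
isOdd (suc n) = not (isOdd n)

isOdd-cong : ∀ {m n} → m ≈ n [ 2 ] → isOdd m ≡ isOdd n
isOdd-cong {m} {n} (mk≈ p) = trans (odd%2 m) (trans (cong isOdd p) (sym (odd%2 n)))
  where
  odd%2 : ∀ m → isOdd m ≡ isOdd (m % 2)
  odd%2 0 = refl
  odd%2 1 = refl
  odd%2 (suc (suc m)) = trans (Bool.not-involutive (isOdd m)) (odd%2 m)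

-- `pos X` is one reference occurrence of X; `placed` compares an occurrence of X directly followed
-- by Y with the two references.
record Placement (V : List Var) (R : Var → Var → Set) : Set where
  field
    pos len : Var → ℕ
    len-pos : ∀ {X} → X ∈ V → 0 < len X
    R⊆V     : ∀ {X Y} → R X Y → X ∈ V × Y ∈ V
    placed  : ∀ {X Y} → R X Y → ∃ λ c → Match c (pos X) (len X) × Match (c + len X) (pos Y) (len Y)

-- The value of `start X` (`end X`) is the side of the left (right) border of X in a
-- two-colouring of the adjacency graph; a free variable has its borders on different sides.
record Labelling (V : List Var) (R : Var → Var → Set) : Set where
  field
    start end  : Var → Bool
    consistent : ∀ {X Y} → R X Y → end X ≡ start Y
    free       : Var
    free∈V     : free ∈ V
    isFree     : start free ≢ end free

module _ {V : List Var} {R : Var → Var → Set} where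
  open Placement

  half-placement : (P : Placement V R) → (∀ {X} → X ∈ V → 1 < len P X) → Placement V R
  half-placement P long = record
    { pos = λ X → ⌈ pos P X /2⌉
    ; len = λ X → half-length (pos P X) (len P X)
    ; len-pos = λ {X} m → half-length-pos (pos P X) (len P X) (long m)
    ; R⊆V = R⊆V P
    ; placed = halved }
    where
    halved : ∀ {X Y} → R X Y → ∃ λ c → Match c ⌈ pos P X /2⌉ (half-length (pos P X) (len P X)) ×
      Match (c + half-length (pos P X) (len P X)) ⌈ pos P Y /2⌉ (half-length (pos P Y) (len P Y))
    halved {X} {Y} r with placed P r | R⊆V P r
    ... | c , M , N | X∈V , Y∈V = ⌈ c /2⌉ ,
      subst (Match _ _) eqX (Match-half c≈ M) ,
      subst₂ (λ i n → Match i ⌈ pos P Y /2⌉ n)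
        (trans (⌈c+n/2⌉ c (len P X)) (cong (⌈ c /2⌉ +_) eqX))
        (half-length-cong (len P Y) (≈4⇒≈2 d≈)) (Match-half d≈ N)
      where
      c≈ : c ≈ pos P X [ 4 ]
      c≈ = Match-≈4 (long X∈V) M
      d≈ : c + len P X ≈ pos P Y [ 4 ]
      d≈ = Match-≈4 (long Y∈V) N
      eqX : half-length c (len P X) ≡ half-length (pos P X) (len P X)
      eqX = half-length-cong (len P X) (≈4⇒≈2 c≈)

  -- The length of an arbitrary X in `V` measures the descent: it drops at each halving, and halving
  -- is possible until some variable has length 1.
  labelling : ∀ {X} → X ∈ V → Placement V R → Labelling V R
  labelling {X} X∈V P = <-rec (λ n → (P : Placement V R) → len P X ≡ n → Labelling V R) step _ P refl
    where
    step : ∀ n → (∀ {m} → m < n → (P : Placement V R) → len P X ≡ m → Labelling V R) →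
      (P : Placement V R) → len P X ≡ n → Labelling V R
    step _ rec P refl with any? (λ Y → len P Y ≟ 1) V
    ... | no ¬one = rec (half-length-< (pos P X) (len P X) (long X∈V)) (half-placement P long) refl
      where
      long : ∀ {Y} → Y ∈ V → 1 < len P Y
      long m with one-or-more (len-pos P m)
      ... | inj₁ e = ⊥-elim (¬one (lose m e))
      ... | inj₂ p = p
    ... | yes one with find one
    ... | Y , Y∈V , e = record
      { start = λ Z → isOdd (pos P Z)
      ; end = λ Z → isOdd (pos P Z + len P Z)
      ; consistent = cons
      ; free = Y
      ; free∈V = Y∈V
      ; isFree = λ q → Bool.not-¬ (sym q) (cong isOdd (trans (cong (pos P Y +_) e) (+-comm (pos P Y) 1))) }
      where
      cons : ∀ {Z W} → R Z W → isOdd (pos P Z + len P Z) ≡ isOdd (pos P W)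
      cons r with placed P r | R⊆V P r
      ... | c , M , N | Z∈V , W∈V = isOdd-cong (≈-trans
        (+-cong≈ (≈-sym (Match-≈2 (len-pos P Z∈V) M)) ≈-refl) (Match-≈2 (len-pos P W∈V) N))

-- Occurrences of finite words as slices of an infinite word

module _ {A : Set} where

  slice : InfWord A → ℕ → ℕ → List A
  slice w i zero = []
  slice w i (suc n) = w i ∷ slice w (suc i) n

  OccursAt : List A → InfWord A → ℕ → Set
  OccursAt u w i = slice w i (length u) ≡ u

  length-slice : ∀ w i n → length (slice w i n) ≡ n
  length-slice w i zero = refl
  length-slice w i (suc n) = cong suc (length-slice w (suc i) n)

  slice-occurs : ∀ w i n → OccursAt (slice w i n) w i
  slice-occurs w i n = cong (slice w i) (length-slice w i n)

  factor⇒occurs : ∀ {u w} → Factor u w → ∃ (OccursAt u w)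
  factor⇒occurs {u} {w} (i , p) = i , go u i p
    where
    go : ∀ u i → (∀ j (q : j < length u) → w (i + j) ≡ lookup u (fromℕ< q)) → OccursAt u w i
    go [] i p = refl
    go (x ∷ u) i p = cong₂ _∷_ (trans (cong w (sym (+-identityʳ i))) (p 0 (s≤s z≤n)))
      (go u (suc i) λ j q → trans (cong w (sym (+-suc i j))) (p (suc j) (s≤s q)))

  occurs⇒factor : ∀ {u w i} → OccursAt u w i → Factor u w
  occurs⇒factor {u} {w} {i} o = i , go u i o
    where
    go : ∀ u i → OccursAt u w i → ∀ j (q : j < length u) → w (i + j) ≡ lookup u (fromℕ< q)
    go (x ∷ u) i o zero q = trans (cong w (+-identityʳ i)) (proj₁ (∷-injective o))
    go (x ∷ u) i o (suc j) (s≤s q) = trans (cong w (+-suc i j)) (go u (suc i) (proj₂ (∷-injective o)) j q)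

  occurs-++⁻ : ∀ u {v w i} → OccursAt (u ++ v) w i → OccursAt u w i × OccursAt v w (i + length u)
  occurs-++⁻ [] {v} {w} {i} o = refl , subst (OccursAt v w) (sym (+-identityʳ i)) o
  occurs-++⁻ (x ∷ u) {v} {w} {i} o with ∷-injective o
  ... | p , q with occurs-++⁻ u q
  ... | r , s = cong₂ _∷_ p r , subst (OccursAt v w) (sym (+-suc i (length u))) s

  occurs-++⁺ : ∀ u {v w i} → OccursAt u w i → OccursAt v w (i + length u) → OccursAt (u ++ v) w i
  occurs-++⁺ [] {v} {w} {i} _ o = subst (OccursAt v w) (+-identityʳ i) o
  occurs-++⁺ (x ∷ u) {v} {w} {i} o o′ with ∷-injective o
  ... | p , q = cong₂ _∷_ p (occurs-++⁺ u q (subst (OccursAt v w) (+-suc i (length u)) o′))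

  slice-≡⇒ : ∀ (w : InfWord A) c c′ n → slice w c n ≡ slice w c′ n → ∀ {i} → i < n → w (c + i) ≡ w (c′ + i)
  slice-≡⇒ w c c′ (suc n) eq {zero} _ = subst₂ (λ x y → w x ≡ w y) (sym (+-identityʳ c)) (sym (+-identityʳ c′)) (proj₁ (∷-injective eq))
  slice-≡⇒ w c c′ (suc n) eq {suc i} (s≤s p) = subst₂ (λ x y → w x ≡ w y) (sym (+-suc c i)) (sym (+-suc c′ i))
    (slice-≡⇒ w (suc c) (suc c′) n (proj₂ (∷-injective eq)) p)

  slice-≡⇐ : ∀ (w : InfWord A) c c′ n → (∀ {i} → i < n → w (c + i) ≡ w (c′ + i)) → slice w c n ≡ slice w c′ n
  slice-≡⇐ w c c′ zero eq = refl
  slice-≡⇐ w c c′ (suc n) eq = cong₂ _∷_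
    (subst₂ (λ x y → w x ≡ w y) (+-identityʳ c) (+-identityʳ c′) (eq (s≤s z≤n)))
    (slice-≡⇐ w (suc c) (suc c′) n λ {i} p → subst₂ (λ x y → w x ≡ w y) (+-suc c i) (+-suc c′ i) (eq (s≤s p)))

occurs⇒Match : ∀ {u c c′} → OccursAt u b4ℕ c → OccursAt u b4ℕ c′ → Match c c′ (length u)
occurs⇒Match {u} {c} {c′} o o′ = mkMatch (slice-≡⇒ b4ℕ c c′ (length u) (trans o (sym o′)))

-- Zimin words

zimin : ℕ → List ℕ
zimin zero = []
zimin (suc n) = zimin n ++ n ∷ zimin n

interleave : List ℕ → List ℕ
interleave = concatMap λ a → 0 ∷ suc a ∷ []

-- The recursion through the largest letter serves unavoidability; this one, through the smallest
-- letter, serves the reinsertion of a variable.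
zimin-interleave : ∀ n → zimin (suc n) ≡ interleave (zimin n) ++ [ 0 ]
zimin-interleave zero = refl
zimin-interleave (suc n) = begin
  zimin (suc n) ++ suc n ∷ zimin (suc n)       ≡⟨ cong (λ z → z ++ suc n ∷ z) (zimin-interleave n) ⟩
  (D ++ [ 0 ]) ++ suc n ∷ D ++ [ 0 ]           ≡⟨ ++-assoc D _ _ ⟩
  D ++ 0 ∷ suc n ∷ D ++ [ 0 ]                  ≡⟨ ++-assoc D _ _ ⟨
  (D ++ 0 ∷ suc n ∷ D) ++ [ 0 ]                ≡⟨ cong (_++ [ 0 ]) (concatMap-++ _ (zimin n) (n ∷ zimin n)) ⟨
  interleave (zimin (suc n)) ++ [ 0 ]          ∎
  where
  open ≡-Reasoning
  D : List ℕ
  D = interleave (zimin n)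

zimin-< : ∀ n → All (_< n) (zimin n)
zimin-< zero = []
zimin-< (suc n) = ++⁺ small (n<1+n n ∷ small)
  where
  small : All (_< suc n) (zimin n)
  small = All.map m<n⇒m<1+n (zimin-< n)

concatMap-≢[] : ∀ {A B : Set} (G : A → List B) → (∀ a → G a ≢ []) → ∀ {u} → u ≢ [] → concatMap G u ≢ []
concatMap-≢[] G ne {[]} p = ⊥-elim (p refl)
concatMap-≢[] G ne {a ∷ u} _ q with G a | ne a
... | [] | r = r refl
concatMap-≢[] G ne {a ∷ u} _ () | _ ∷ _ | _

module _ {A : Set} where

  update : ℕ → List A → (ℕ → List A) → ℕ → List A
  update n v G a with a ≟ n
  ... | yes _ = v
  ... | no _ = G a

  update-≡ : ∀ n v G → update n v G n ≡ v
  update-≡ n v G with n ≟ n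
  ... | yes _ = refl
  ... | no p = ⊥-elim (p refl)

  update-≢[] : ∀ n {v} {G} → v ≢ [] → (∀ a → G a ≢ []) → ∀ a → update n v G a ≢ []
  update-≢[] n p q a with a ≟ n
  ... | yes _ = p
  ... | no _ = q a

  concatMap-update : ∀ n v G {u} → All (_< n) u → concatMap (update n v G) u ≡ concatMap G u
  concatMap-update n v G [] = refl
  concatMap-update n v G {a ∷ u} (p ∷ ps) = cong₂ _++_ same (concatMap-update n v G ps)
    where
    same : update n v G a ≡ G a
    same with a ≟ n
    ... | yes refl = ⊥-elim (<-irrefl refl p)
    ... | no _ = refl

-- The offset is relative to the window of `N` letters at `a`, so that windows with equal contents
-- contain the image at the same place.
record ZiminIn {k} (n N : ℕ) (w : InfWord (Fin k)) (a : ℕ) : Set where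
  field
    letters  : ℕ → List (Fin k)
    letters≢ : ∀ i → letters i ≢ []
    offset   : ℕ
    bounded  : offset + length (concatMap letters (zimin n)) ≤ N
    occurs   : OccursAt (concatMap letters (zimin n)) w (a + offset)

-- Among k ^ N + 1 blocks of length N, two are equal, hence contain the same image of zimin n
-- at the same offset; blocks are one letter apart so that the middle word is not empty.
zimin-unavoidable : ∀ k n → ∃ λ N → (w : InfWord (Fin k)) → ∀ a → ZiminIn n N w a
zimin-unavoidable k zero = 0 , λ w a → record
  { letters = λ _ → [ w 0 ] ; letters≢ = λ _ () ; offset = 0 ; bounded = z≤n ; occurs = refl }
zimin-unavoidable k (suc n) with zimin-unavoidable k n
-- The last block, number `k ^ N`, starts after `k ^ N * suc N` letters and has `N` letters.
... | N , ih = k ^ N * suc N + N , found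
  where
  module _ (w : InfWord (Fin k)) (a : ℕ) where
    blockAt : ℕ → ℕ
    blockAt t = a + t * suc N

    block : Fin (suc (k ^ N)) → Fin (k ^ N)
    block t = funToFin λ (j : Fin N) → w (blockAt (toℕ t) + toℕ j)

    found : ZiminIn (suc n) (k ^ N * suc N + N) w a
    found with pigeonhole (n<1+n (k ^ N)) block
    ... | t , t′ , t<t′ , eq = record
      { letters = G
      ; letters≢ = update-≢[] n gap≢[] letters≢
      ; offset = toℕ t * suc N + offset
      ; bounded = subst (λ v → toℕ t * suc N + offset + length v ≤ k ^ N * suc N + N) (sym image) end
      ; occurs = subst₂ (λ v i → OccursAt v w i) (sym image) (+-assoc a (toℕ t * suc N) offset)
          (occurs-++⁺ u occurs (occurs-++⁺ gap gap-occurs second)) }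
      where
      open ZiminIn (ih w (blockAt (toℕ t)))
      u gap : List (Fin k)
      u = concatMap letters (zimin n)
      G : ℕ → List (Fin k)

      i i′ d : ℕ
      i = blockAt (toℕ t) + offset
      i′ = blockAt (toℕ t′) + offset

      i+u<i′ : i + length u < i′
      i+u<i′ = begin-strict
        blockAt (toℕ t) + offset + length u   ≡⟨ +-assoc (blockAt (toℕ t)) offset _ ⟩
        blockAt (toℕ t) + (offset + length u) ≤⟨ +-monoʳ-≤ (blockAt (toℕ t)) bounded ⟩
        blockAt (toℕ t) + N                   <⟨ +-monoʳ-< (blockAt (toℕ t)) (n<1+n N) ⟩
        blockAt (toℕ t) + suc N               ≡⟨ +-assoc a _ _ ⟩
        a + (toℕ t * suc N + suc N)           ≡⟨ cong (a +_) (+-comm (toℕ t * suc N) (suc N)) ⟩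
        a + suc (toℕ t) * suc N               ≤⟨ +-monoʳ-≤ a (*-monoˡ-≤ (suc N) t<t′) ⟩
        blockAt (toℕ t′)                      ≤⟨ m≤m+n _ offset ⟩
        i′                                    ∎
        where open ≤-Reasoning

      d = i′ ∸ (i + length u)
      gap = slice w (i + length u) d
      G = update n gap letters

      gap≢[] : gap ≢ []
      gap≢[] e = <-irrefl (trans (sym (cong length e)) (length-slice w _ d)) (m<n⇒0<n∸m i+u<i′)

      gap-occurs : OccursAt gap w (i + length u)
      gap-occurs = slice-occurs w (i + length u) d

      gap-end : i + length u + length gap ≡ i′
      gap-end = trans (cong (i + length u +_) (length-slice w _ d)) (m+[n∸m]≡n (<⇒≤ i+u<i′))

      image : concatMap G (zimin (suc n)) ≡ u ++ gap ++ u
      image = trans (concatMap-++ G (zimin n) (n ∷ zimin n)) (cong₂ _++_ small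
        (cong₂ _++_ (update-≡ n gap letters) small))
        where
        small : concatMap G (zimin n) ≡ u
        small = concatMap-update n gap letters (zimin-< n)

      blocks≡ : ∀ {j} → j < N → w (blockAt (toℕ t) + j) ≡ w (blockAt (toℕ t′) + j)
      blocks≡ {j} p = subst (λ m → w (blockAt (toℕ t) + m) ≡ w (blockAt (toℕ t′) + m)) (toℕ-fromℕ< p)
        (trans (sym (finToFun-funToFin (λ (j : Fin N) → w (blockAt (toℕ t) + toℕ j)) (fromℕ< p)))
          (trans (cong (λ b → finToFun b (fromℕ< p)) eq)
            (finToFun-funToFin (λ (j : Fin N) → w (blockAt (toℕ t′) + toℕ j)) (fromℕ< p))))

      second : OccursAt u w (i + length u + length gap)
      second = subst (OccursAt u w) (sym gap-end) (trans (sym (slice-≡⇐ w i i′ (length u) λ {j} p →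
        subst₂ (λ x y → w x ≡ w y) (sym (+-assoc (blockAt (toℕ t)) offset j)) (sym (+-assoc (blockAt (toℕ t′)) offset j))
          (blocks≡ (<-≤-trans (+-monoʳ-< offset p) bounded)))) occurs)

      end : toℕ t * suc N + offset + length (u ++ gap ++ u) ≤ k ^ N * suc N + N
      end = +-cancelˡ-≤ a _ _ (begin
        a + (toℕ t * suc N + offset + length (u ++ gap ++ u))  ≡⟨ cong (a +_) (+-assoc (toℕ t * suc N) offset _) ⟩
        a + (toℕ t * suc N + (offset + length (u ++ gap ++ u)))  ≡⟨ +-assoc a _ _ ⟨
        blockAt (toℕ t) + (offset + length (u ++ gap ++ u))  ≡⟨ +-assoc (blockAt (toℕ t)) offset _ ⟨
        i + length (u ++ gap ++ u)  ≡⟨ cong (i +_) (trans (length-++ u) (cong (length u +_) (length-++ gap))) ⟩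
        i + (length u + (length gap + length u)) ≡⟨ +-assoc i _ _ ⟨
        i + length u + (length gap + length u) ≡⟨ +-assoc (i + length u) _ _ ⟨
        i + length u + length gap + length u ≡⟨ cong (_+ length u) gap-end ⟩
        i′ + length u ≡⟨ +-assoc (blockAt (toℕ t′)) offset _ ⟩
        blockAt (toℕ t′) + (offset + length u) ≤⟨ +-monoʳ-≤ (blockAt (toℕ t′)) bounded ⟩
        blockAt (toℕ t′) + N ≡⟨ +-assoc a _ N ⟩
        a + (toℕ t′ * suc N + N) ≤⟨ +-monoʳ-≤ a (+-monoˡ-≤ N (*-monoˡ-≤ (suc N) (≤-pred (toℕ<n t′)))) ⟩
        a + (k ^ N * suc N + N) ∎)
        where open ≤-Reasoning

-- Reduction of a formula

Infix : {A : Set} → List A → List A → Set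
Infix u v = ∃ λ p → ∃ λ q → v ≡ p ++ u ++ q

trim pad : Bool → List ℕ → List ℕ
trim false u = u
trim true u = drop 1 u
pad false u = u
pad true u = u ++ [ 0 ]

-- The interleaving of u with zeros; s and e say whether the zero at the left
-- and at the right border belongs to the left neighbour of that border.
block : Bool → List ℕ → Bool → List ℕ
block s u e = trim s (pad e (interleave u))

-- Trimming needs a leading zero, which the interleaving of the empty word lacks.
NonTrimmed : Bool → List ℕ → Set
NonTrimmed s u = u ≢ [] ⊎ s ≡ false

nonTrimmed-++ : ∀ {s u} v → NonTrimmed s u → NonTrimmed s (u ++ v)
nonTrimmed-++ {u = []} v (inj₁ p) = ⊥-elim (p refl)
nonTrimmed-++ {u = _ ∷ _} v (inj₁ _) = inj₁ λ ()
nonTrimmed-++ v (inj₂ p) = inj₂ p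

pad-++ : ∀ e u v → pad e (u ++ v) ≡ u ++ pad e v
pad-++ false u v = refl
pad-++ true u v = ++-assoc u v [ 0 ]

-- The zero between the two words appears exactly once: either appended on the left and trimmed on
-- the right, or only kept on the right.
border : ∀ u e v t → NonTrimmed e v → pad e u ++ block e v t ≡ u ++ pad t (interleave v)
border u false v t _ = refl
border u true [] t (inj₁ p) = ⊥-elim (p refl)
border u true (a ∷ v) t _ = trans (++-assoc u [ 0 ] _) (cong (u ++_) (lemma t))
  where
  lemma : ∀ t → [ 0 ] ++ block true (a ∷ v) t ≡ pad t (interleave (a ∷ v))
  lemma false = refl
  lemma true = refl

trim-++ : ∀ s u e x → NonTrimmed s u → trim s (pad e (interleave u)) ++ x ≡ trim s (pad e (interleave u) ++ x)
trim-++ false u e x _ = refl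
trim-++ true [] e x (inj₁ p) = ⊥-elim (p refl)
trim-++ true (a ∷ u) false x _ = refl
trim-++ true (a ∷ u) true x _ = refl

block-++ : ∀ {s u e v} t → NonTrimmed s u → NonTrimmed e v → block s u e ++ block e v t ≡ block s (u ++ v) t
block-++ {s} {u} {e} {v} t p q = begin
  block s u e ++ block e v t                       ≡⟨ trim-++ s u e _ p ⟩
  trim s (pad e (interleave u) ++ block e v t)     ≡⟨ cong (trim s) (border (interleave u) e v t q) ⟩
  trim s (interleave u ++ pad t (interleave v))    ≡⟨ cong (trim s) (pad-++ t (interleave u) (interleave v)) ⟨
  trim s (pad t (interleave u ++ interleave v))    ≡⟨ cong (λ x → trim s (pad t x)) (concatMap-++ _ u v) ⟨
  block s (u ++ v) t                               ∎
  where open ≡-Reasoning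

block-≢[] : ∀ s {u} e → u ≢ [] → block s u e ≢ []
block-≢[] s {[]} e p = ⊥-elim (p refl)
block-≢[] false {_ ∷ _} false _ ()
block-≢[] false {_ ∷ _} true _ ()
block-≢[] true {_ ∷ _} false _ ()
block-≢[] true {_ ∷ _} true _ ()

infix-trim : ∀ s {u v : List ℕ} → Infix u v → Infix (trim s u) v
infix-trim false i = i
infix-trim true {[]} i = i
infix-trim true {a ∷ u} (p , q , eq) = p ++ [ a ] , q , trans eq (sym (++-assoc p [ a ] (u ++ q)))

-- The zero requested by `e` opens the interleaving of `q` or, for empty `q`, is the final zero of
-- `zimin (suc n)`.
infix-block : ∀ {u n} s e → Infix u (zimin n) → Infix (block s u e) (zimin (suc n))
infix-block {u} {n} s e (p , q , eq) = infix-trim s (interleave p , proj₁ (after e q) , (begin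
  zimin (suc n)                                            ≡⟨ zimin-interleave n ⟩
  interleave (zimin n) ++ [ 0 ]                            ≡⟨ cong (λ z → interleave z ++ [ 0 ]) eq ⟩
  interleave (p ++ u ++ q) ++ [ 0 ]                        ≡⟨ cong (_++ [ 0 ]) (concatMap-++ _ p (u ++ q)) ⟩
  (interleave p ++ interleave (u ++ q)) ++ [ 0 ]           ≡⟨ ++-assoc (interleave p) _ _ ⟩
  interleave p ++ interleave (u ++ q) ++ [ 0 ]             ≡⟨ cong (λ x → interleave p ++ x ++ [ 0 ]) (concatMap-++ _ u q) ⟩
  interleave p ++ (interleave u ++ interleave q) ++ [ 0 ]  ≡⟨ cong (interleave p ++_) (++-assoc (interleave u) _ _) ⟩
  interleave p ++ interleave u ++ interleave q ++ [ 0 ]    ≡⟨ cong (interleave p ++_) (proj₂ (after e q)) ⟩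
  interleave p ++ pad e (interleave u) ++ proj₁ (after e q) ∎))
  where
  open ≡-Reasoning
  after : ∀ e q → ∃ λ r → interleave u ++ interleave q ++ [ 0 ] ≡ pad e (interleave u) ++ r
  after false q = interleave q ++ [ 0 ] , refl
  after true [] = [] , sym (++-identityʳ _)
  after true (a ∷ q) = suc a ∷ interleave q ++ [ 0 ] , sym (++-assoc (interleave u) [ 0 ] _)

infix-occurs : ∀ {A : Set} (G : ℕ → List A) {u v w i} → Infix u v → OccursAt (concatMap G v) w i →
  Factor (concatMap G u) w
infix-occurs G {u} {v} {w} {i} (p , q , refl) o = occurs⇒factor (proj₁ (occurs-++⁻ (concatMap G u)
  (subst (λ x → OccursAt x w _) (concatMap-++ G u q) (proj₂ (occurs-++⁻ (concatMap G p)
    (subst (λ x → OccursAt x w i) (concatMap-++ G p (u ++ q)) o))))))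

letter-occurs : ∀ {A : Set} (h : Var → List A) {φ X w i} → X ∈ φ → OccursAt (concatMap h φ) w i → ∃ (OccursAt (h X) w)
letter-occurs h {Y ∷ φ} (here refl) o = _ , proj₁ (occurs-++⁻ (h Y) o)
letter-occurs h {Y ∷ φ} (there m) o = letter-occurs h m (proj₂ (occurs-++⁻ (h Y) o))

open DecMembership _≟_ using (_∈?_)
open DecMembership (≡-dec _≟_) using () renaming (_∈?_ to _∈ᶠ?_)

module Reduction (f : Formula) (h : Var → List ℕ) (occ : Occurrence f b4ℕ h) where

  Triple : Var → Var → Set
  Triple Y X = (Y ∷ X ∷ Y ∷ []) ∈ f

  triple? : ∀ Y X → Dec (Triple Y X)
  triple? Y X = (Y ∷ X ∷ Y ∷ []) ∈ᶠ? f

  ∣h∣ : Var → ℕ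
  ∣h∣ X = length (h X)

  ∣h∣-pos : ∀ X → 0 < ∣h∣ X
  ∣h∣-pos X with h X | proj₁ occ X
  ... | [] | p = ⊥-elim (p refl)
  ... | _ ∷ _ | _ = s≤s z≤n

  occursFragment : ∀ {φ} → φ ∈ f → ∃ (OccursAt (concatMap h φ) b4ℕ)
  occursFragment m = factor⇒occurs (proj₂ occ _ m)

  triple-parts : ∀ {Y X c} → OccursAt (h Y ++ h X ++ h Y ++ []) b4ℕ c →
    OccursAt (h Y) b4ℕ c × OccursAt (h X) b4ℕ (c + ∣h∣ Y) × OccursAt (h Y) b4ℕ (c + ∣h∣ Y + ∣h∣ X)
  triple-parts {Y} {X} o with occurs-++⁻ (h Y) o
  ... | p , q with occurs-++⁻ (h X) q
  ... | r , s = p , r , proj₁ (occurs-++⁻ (h Y) s)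

  -- Walks from middle to outer variables

  module Walk (next : Var → Var) (x₀ : Var) where

    walk : ℕ → Var
    walk zero = x₀
    walk (suc k) = next (walk k)

    walk-periodic : ∀ i n → walk (i + n) ≡ walk i → ∀ k → walk (i + (k + n)) ≡ walk (i + k)
    walk-periodic i n e zero = trans e (cong walk (sym (+-identityʳ i)))
    walk-periodic i n e (suc k) = trans (cong walk (+-suc i (k + n)))
      (trans (cong next (walk-periodic i n e k)) (cong walk (sym (+-suc i k))))

    module _ (triples : ∀ k → Triple (walk (suc k)) (walk k)) where

      -- Depends on the variable and not on the index in the walk, so a periodic walk has periodic
      -- positions. The default 0 is never met on the walk.
      leftPos : Var → ℕ
      leftPos X with triple? (next X) X
      ... | yes m = proj₁ (occursFragment m)
      ... | no _ = 0

      leftPos-occurs : ∀ k → OccursAt (h (walk (suc k)) ++ h (walk k) ++ h (walk (suc k)) ++ []) b4ℕ (leftPos (walk k))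
      leftPos-occurs k with triple? (next (walk k)) (walk k)
      ... | yes m = proj₂ (occursFragment m)
      ... | no ¬m = ⊥-elim (¬m (triples k))

      middlePos : Var → ℕ
      middlePos X = leftPos X + ∣h∣ (next X)

      walk-step : ∀ k → Step (middlePos (walk k)) (∣h∣ (walk k)) (leftPos (walk k)) (middlePos (walk (suc k))) (∣h∣ (walk (suc k)))
      walk-step k with triple-parts (leftPos-occurs k) | triple-parts (leftPos-occurs (suc k))
      ... | l , _ , r | _ , m , _ = record
        { adjacent = refl
        ; nonEmpty = ∣h∣-pos (walk (suc k))
        ; left = occurs⇒Match l m
        ; right = occurs⇒Match r m }

      ¬return : ∀ i n → walk (i + suc n) ≢ walk i
      ¬return i n e = ¬Cycle record
        { a = λ k → middlePos (walk (i + k))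
        ; ℓ = λ k → ∣h∣ (walk (i + k))
        ; c = λ k → leftPos (walk (i + k))
        ; n = n
        ; a-per = λ k → cong middlePos (walk-periodic i (suc n) e k)
        ; ℓ-per = λ k → cong ∣h∣ (walk-periodic i (suc n) e k)
        ; step = λ k → subst
            (λ X → Step (middlePos (walk (i + k))) (∣h∣ (walk (i + k))) (leftPos (walk (i + k))) (middlePos X) (∣h∣ X))
            (cong walk (sym (+-suc i k))) (walk-step (i + k)) }

      ¬inside : (V : List Var) → ¬ (∀ k → walk k ∈ V)
      ¬inside V inV with pigeonhole (n<1+n (length V)) (λ i → index (inV (toℕ i)))
      ... | i , j , i<j , e with m≤n⇒∃[o]m+o≡n i<j
      ... | n , eq = ¬return (toℕ i) n (trans (cong walk (trans (+-suc (toℕ i) n) eq))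
        (trans (lookup-index (inV (toℕ j))) (trans (cong (lookup V) (sym e)) (sym (lookup-index (inV (toℕ i)))))))

  -- Adjacency graph and free variables of the formula

  Link : List Var → Var → Var → Set
  Link V X Y = (X ∈ V × Y ∈ V) × ((X ∷ Y ∷ []) ∈ f ⊎ Triple X Y ⊎ Triple Y X)

  link-occurs : ∀ {V X Y} → Link V X Y → ∃ λ c → OccursAt (h X) b4ℕ c × OccursAt (h Y) b4ℕ (c + ∣h∣ X)
  link-occurs {X = X} {Y} (_ , inj₁ m) with occursFragment m
  ... | c , o with occurs-++⁻ (h X) o
  ... | p , q = c , p , proj₁ (occurs-++⁻ (h Y) q)
  link-occurs (_ , inj₂ (inj₁ m)) with occursFragment m
  ... | c , o with triple-parts o
  ... | p , q , _ = c , p , q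
  link-occurs (_ , inj₂ (inj₂ m)) with occursFragment m
  ... | c , o with triple-parts o
  ... | _ , p , q = _ , p , q

  vars : List Var
  vars = concat f

  somewhere : ∀ {X} → X ∈ vars → ∃ (OccursAt (h X) b4ℕ)
  somewhere m with ∈-concat⁻′ f m
  ... | φ , X∈φ , φ∈f = letter-occurs h X∈φ (proj₂ (occursFragment φ∈f))

  placement : ∀ {V} → (∀ {X} → X ∈ V → X ∈ vars) → Placement V (Link V)
  placement {V} V⊆ = record
    { pos = pos ; len = ∣h∣ ; len-pos = λ {X} _ → ∣h∣-pos X ; R⊆V = proj₁ ; placed = placed }
    where
    pos : Var → ℕ
    pos X with X ∈? vars
    ... | yes m = proj₁ (somewhere m)
    ... | no _ = 0
    pos-occurs : ∀ {X} → X ∈ V → OccursAt (h X) b4ℕ (pos X)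
    pos-occurs {X} X∈V with X ∈? vars
    ... | yes m = proj₂ (somewhere m)
    ... | no ¬m = ⊥-elim (¬m (V⊆ X∈V))
    placed : ∀ {X Y} → Link V X Y → ∃ λ c → Match c (pos X) (∣h∣ X) × Match (c + ∣h∣ X) (pos Y) (∣h∣ Y)
    placed r@((X∈V , Y∈V) , _) with link-occurs r
    ... | c , p , q = c , occurs⇒Match p (pos-occurs X∈V) , occurs⇒Match q (pos-occurs Y∈V)

  -- With these labels the emptied variable receives `block false [] true`, a single zero; `¬middle`
  -- prevents deletion from leaving a square YY.
  record FreeVariable (V : List Var) : Set where
    field
      start end  : Var → Bool
      consistent : ∀ {X Y} → Link V X Y → end X ≡ start Y
      free       : Var
      free∈V     : free ∈ V
      start-free : start free ≡ false
      end-free   : end free ≡ true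
      ¬middle    : ∀ {Y} → Y ∈ V → ¬ Triple Y free

  module _ {V : List Var} (L : Labelling V (Link V)) where
    open Labelling L

    Middle : Var → Set
    Middle X = Any (λ Y → Triple Y X) V

    middle? : ∀ X → Dec (Middle X)
    middle? X = any? (λ Y → triple? Y X) V

    normalise : ∀ X → X ∈ V → start X ≢ end X → ¬ Middle X → FreeVariable V
    normalise X X∈V p ¬mid with start X in eqs | end X in eqe
    ... | false | false = ⊥-elim (p refl)
    ... | true | true = ⊥-elim (p refl)
    ... | false | true = record
      { start = start ; end = end ; consistent = consistent ; free = X ; free∈V = X∈V
      ; start-free = eqs ; end-free = eqe ; ¬middle = λ Y∈V t → ¬mid (lose Y∈V t) }
    -- Complementing all labels preserves consistency.
    ... | true | false = record
      { start = λ Y → not (start Y) ; end = λ Y → not (end Y) ; consistent = λ r → cong not (consistent r)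
      ; free = X ; free∈V = X∈V
      ; start-free = cong not eqs ; end-free = cong not eqe ; ¬middle = λ Y∈V t → ¬mid (lose Y∈V t) }

    -- If every free variable were the middle of some Y X Y, then, as such Y are free
    -- too, walking from middles to outer variables would produce a cycle.
    freeVariable : FreeVariable V
    freeVariable with any? (λ X → ¬? (start X Bool.≟ end X) ×-dec ¬? (middle? X)) V
    ... | yes found with find found
    ... | X , X∈V , p , ¬mid = normalise X X∈V p ¬mid
    freeVariable | no none = ⊥-elim (Walk.¬inside next free (λ k → proj₂ (outer (proj₁ (good k)) (proj₂ (good k)))) V (λ k → proj₁ (good k)))
      where
      next : Var → Var
      next X with middle? X
      ... | yes m = proj₁ (find m)
      ... | no _ = X
      outer : ∀ {X} → X ∈ V → start X ≢ end X → next X ∈ V × Triple (next X) X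
      outer {X} X∈V p with middle? X
      ... | yes m = proj₂ (find m)
      ... | no ¬m = ⊥-elim (none (lose X∈V (p , ¬m)))
      good : ∀ k → Walk.walk next free k ∈ V × start (Walk.walk next free k) ≢ end (Walk.walk next free k)
      good zero = free∈V , isFree
      good (suc k) with good k
      ... | X∈V , p with outer X∈V p
      -- In Y X Y the end of Y is labelled as the start of X and the start of Y as the end of X, so
      -- Y is free with X.
      ... | Y∈V , t = Y∈V , λ e → p (trans (sym (consistent ((Y∈V , X∈V) , inj₂ (inj₁ t))))
        (trans (sym e) (sym (consistent ((X∈V , Y∈V) , inj₂ (inj₂ t))))))

  -- Deleting a variable can leave a fragment with a single variable, which need not be a fragment
  -- of `f`; hence `single`.
  record ZiminOccurrence (V : List Var) : Set where
    field
      n        : ℕ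
      g        : Var → List ℕ
      g≢[]     : ∀ X → g X ≢ []
      single   : ∀ {X} → X ∈ V → Infix (g X) (zimin n)
      fragment : ∀ {φ} → φ ∈ f → HybridFragment φ → All (_∈ V) φ → Infix (concatMap g φ) (zimin n)

  -- Reinsertion of a deleted free variable

  module Insertion {V : List Var} (F : FreeVariable V) where
    open FreeVariable F

    other? : ∀ Y → Dec (Y ≢ free)
    other? Y = ¬? (Y ≟ free)

    rest : List Var
    rest = filter other? V

    module _ (Z : ZiminOccurrence rest) where
      open ZiminOccurrence Z

      g₀ : Var → List ℕ
      g₀ Y with Y ≟ free
      ... | yes _ = []
      ... | no _ = g Y

      data View (Y : Var) : Set where
        isFree  : Y ≡ free → g₀ Y ≡ [] → View Y
        isOther : (Y ∈ V → Y ∈ rest) → Y ≢ free → g₀ Y ≡ g Y → View Y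

      view : ∀ Y → View Y
      view Y with Y ≟ free in eq
      ... | yes p = isFree p lemma
        where
        lemma : g₀ Y ≡ []
        lemma rewrite eq = refl
      ... | no p = isOther (λ m → ∈-filter⁺ other? m p) p lemma
        where
        lemma : g₀ Y ≡ g Y
        lemma rewrite eq = refl

      nonTrimmed : ∀ Y → NonTrimmed (start Y) (g₀ Y)
      nonTrimmed Y with view Y
      ... | isFree refl _ = inj₂ start-free
      ... | isOther _ _ e = inj₁ λ q → g≢[] Y (trans (sym e) q)

      g′ : Var → List ℕ
      g′ Y = block (start Y) (g₀ Y) (end Y)

      g′≢[] : ∀ Y → g′ Y ≢ []
      g′≢[] Y with view Y
      ... | isFree refl e rewrite e | start-free | end-free = λ ()
      ... | isOther _ _ e = block-≢[] (start Y) (end Y) λ q → g≢[] Y (trans (sym e) q)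

      infix-[] : Infix [] (zimin n)
      infix-[] = [] , zimin n , refl

      single₀ : ∀ {Y} → Y ∈ V → Infix (g₀ Y) (zimin n)
      single₀ {Y} m with view Y
      ... | isFree _ e rewrite e = infix-[]
      ... | isOther k _ e rewrite e = single (k m)

      pair₀ : ∀ {X Y} → (X ∷ Y ∷ []) ∈ f → X ∈ V → Y ∈ V → Infix (g₀ X ++ g₀ Y) (zimin n)
      pair₀ {X} {Y} m X∈V Y∈V with view X | view Y
      ... | isFree _ e | _ rewrite e = single₀ Y∈V
      ... | isOther k _ e | isFree _ e′ rewrite e′ | ++-identityʳ (g₀ X) = single₀ X∈V
      ... | isOther k _ e | isOther k′ _ e′ rewrite e | e′ = subst (λ v → Infix (g X ++ v) (zimin n)) (++-identityʳ (g Y))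
        (fragment m (inj₁ refl) (k X∈V ∷ k′ Y∈V ∷ []))

      triple₀ : ∀ {X Y} → Triple X Y → X ∈ V → Y ∈ V → Infix (g₀ X ++ g₀ Y ++ g₀ X) (zimin n)
      triple₀ {X} {Y} m X∈V Y∈V with view X | view Y
      ... | isFree _ e | _ rewrite e | ++-identityʳ (g₀ Y) = single₀ Y∈V
      -- Here the deletion would turn X Y X into the square XX.
      ... | isOther k _ e | isFree refl e′ = ⊥-elim (¬middle X∈V m)
      ... | isOther k _ e | isOther k′ _ e′ rewrite e | e′ = subst (λ v → Infix (g X ++ g Y ++ v) (zimin n)) (++-identityʳ (g X))
        (fragment m (inj₂ (X , Y , refl)) (k X∈V ∷ k′ Y∈V ∷ k X∈V ∷ []))

      -- `consistent` makes X and Y agree on which of them owns the zero at their common border.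
      glue : ∀ {X Y} → Link V X Y → ∀ v t → NonTrimmed (start Y) v →
        g′ X ++ block (start Y) v t ≡ block (start X) (g₀ X ++ v) t
      glue {X} {Y} r v t p = trans (cong (λ s → g′ X ++ block s v t) (sym (consistent r)))
        (block-++ t (nonTrimmed X) (subst (λ s → NonTrimmed s v) (sym (consistent r)) p))

      fragment′ : ∀ {φ} → φ ∈ f → HybridFragment φ → All (_∈ V) φ → Infix (concatMap g′ φ) (zimin (suc n))
      fragment′ {X ∷ Y ∷ []} m (inj₁ _) (X∈V ∷ Y∈V ∷ []) =
        subst (λ v → Infix v (zimin (suc n)))
          (sym (trans (cong (g′ X ++_) (++-identityʳ (g′ Y))) (glue ((X∈V , Y∈V) , inj₁ m) (g₀ Y) (end Y) (nonTrimmed Y))))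
          (infix-block (start X) (end Y) (pair₀ m X∈V Y∈V))
      fragment′ {X ∷ Y ∷ X ∷ []} m (inj₂ (_ , _ , refl)) (X∈V ∷ Y∈V ∷ _ ∷ []) =
        subst (λ v → Infix v (zimin (suc n)))
          (sym (trans (cong (λ v → g′ X ++ g′ Y ++ v) (++-identityʳ (g′ X)))
            (trans (cong (g′ X ++_) (glue ((Y∈V , X∈V) , inj₂ (inj₂ m)) (g₀ X) (end X) (nonTrimmed X)))
              (glue ((X∈V , Y∈V) , inj₂ (inj₁ m)) (g₀ Y ++ g₀ X) (end X) (nonTrimmed-++ (g₀ X) (nonTrimmed Y))))))
          (infix-block (start X) (end X) (triple₀ m X∈V Y∈V))

      insert : ZiminOccurrence V
      insert = record { n = suc n ; g = g′ ; g≢[] = g′≢[]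
        ; single = λ {Y} m → infix-block (start Y) (end Y) (single₀ m) ; fragment = fragment′ }

  -- Every round labels the remaining variables anew from the same occurrence `h`; the bound `k`
  -- makes the recursion structural.
  ziminOccurrence : ∀ k V → length V ≤ k → (∀ {X} → X ∈ V → X ∈ vars) → ZiminOccurrence V
  ziminOccurrence k [] _ _ = record
    { n = 0 ; g = λ _ → [ 0 ] ; g≢[] = λ _ () ; single = λ () ; fragment = λ { _ _ [] → [] , [] , refl ; _ _ (() ∷ _) } }
  ziminOccurrence (suc k) V@(_ ∷ _) V≤ V⊆ = Insertion.insert F (ziminOccurrence k rest
    (≤-pred (≤-trans (filter-notAll other? V (lose free∈V λ p → p refl)) V≤))
    (λ m → V⊆ (proj₁ (∈-filter⁻ other? m))))
    where
    F : FreeVariable V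
    F = freeVariable (labelling (here refl) (placement V⊆))
    open FreeVariable F
    open Insertion F

-- Transfer from Zimin words to any infinite word over a finite alphabet

concatMap-concatMap : ∀ {A B C : Set} (G : B → List C) (g : A → List B) u →
  concatMap (λ a → concatMap G (g a)) u ≡ concatMap G (concatMap g u)
concatMap-concatMap G g [] = refl
concatMap-concatMap G g (a ∷ u) =
  trans (cong (concatMap G (g a) ++_) (concatMap-concatMap G g u)) (sym (concatMap-++ G (g a) (concatMap g u)))

theorem14 : (f : Formula) → Hybrid f → Avoidable f → Avoids b4ℕ f
-- `w` contains an image of `zimin n`; composing that image with `g` gives an occurrence of `f` in
-- `w`.
theorem14 f hybrid (k , w , avoids) (h , occ) = avoids ((λ X → concatMap letters (g X)) ,
  (λ X → concatMap-≢[] letters letters≢ (g≢[] X)) ,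
  λ φ m → subst (λ v → Factor v w) (sym (concatMap-concatMap letters g φ))
    (infix-occurs letters (fragment m (All.lookup hybrid m) (All.tabulate λ X∈φ → ∈-concat⁺′ X∈φ m)) occurs))
  where
  open Reduction f h occ
  open ZiminOccurrence (ziminOccurrence (length vars) vars ≤-refl λ m → m)
  open ZiminIn (proj₂ (zimin-unavoidable k n) w 0)
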